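{- If $T$ is a tree of order $n\ge 2$, then $\gamma_{\rm gr}^t(T) = n$ if and only if $T$ has a perfect matching.
   Context: $N(v)$ denotes the open neighborhood of $v$. A sequence $S=(v_1,\ldots,v_k)$ of distinct vertices of a graph $G$ without isolated vertices is a legal sequence if $N(v_i)\setminus \bigcup_{j=1}^{i-1} N(v_j)\neq\emptyset$ for every $i\in\{2,\ldots,k\}$, and a total dominating sequence if moreover $\{v_1,\ldots,v_k\}$ is a total dominating set of $G$ (every vertex has a neighbor in it). $\gamma_{\rm gr}^t(G)$ is the maximum length of a total dominating sequence of $G$. -}

module Defs where

open import Data.Nat.Base using (ℕ; suc; _≤_; _<_)
open import Data.Nat.Properties using (≤-antisym)
open import Data.Fin.Base as Fin using (Fin; zero; toℕ; fromℕ; inject₁)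
open import Data.Product.Base using (∃; ∃-syntax; _×_; _,_)
open import Function.Definitions using (Injective)
open import Level using (0ℓ)
open import Relation.Binary.Core using (Rel; _⇒_)
open import Relation.Binary.Definitions using (Symmetric; Irreflexive; Decidable)
open import Relation.Binary.Construct.Closure.ReflexiveTransitive using (Star)
open import Relation.Binary.PropositionalEquality.Core using (_≡_)
open import Relation.Nullary.Negation.Core using (¬_)
open import Relation.Unary using (Pred; _∈_; _∉_)

-- Finite simple graphs of order n, on the vertex set Fin n.
record Graph (n : ℕ) : Set₁ where
  field
    Adj    : Rel (Fin n) 0ℓ
    sym    : Symmetric Adj
    irrefl : Irreflexive _≡_ Adj
    adj?   : Decidable Adj

module _ {n : ℕ} (G : Graph n) where
  open Graph G

  N : Fin n → Pred (Fin n) 0ℓ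
  N v u = Adj v u

  Connected : Set
  Connected = ∀ u v → Star Adj u v

  -- A cycle c₀ c₁ … cₘ c₀ on m + 1 ≥ 3 distinct vertices.
  record Cycle : Set where
    field
      {m}       : ℕ
      2≤m       : 2 ≤ m
      c         : Fin (suc m) → Fin n
      distinct  : Injective _≡_ _≡_ c
      step      : (i : Fin m) → Adj (c (inject₁ i)) (c (Fin.suc i))
      close     : Adj (c (fromℕ m)) (c zero)

  record IsTree : Set where
    field
      nonempty  : 0 < n
      connected : Connected
      acyclic   : ¬ Cycle

  -- Sequences are indexed from 0, so the condition for i ∈ {2,…,k} becomes
  -- the one for 0 < i.  The witness w is an element of
  -- N(sᵢ) ∖ ⋃ { N(sⱼ) ∣ j < i }.
  record IsLegal {k : ℕ} (s : Fin k → Fin n) : Set where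
    field
      distinct  : Injective _≡_ _≡_ s
      footprint : (i : Fin k) → 0 < toℕ i →
                  ∃[ w ] (w ∈ N (s i) × ((j : Fin k) → j Fin.< i → w ∉ N (s j)))

  IsTotalDominatingSet : Pred (Fin n) 0ℓ → Set
  IsTotalDominatingSet D = ∀ v → ∃[ u ] (u ∈ N v × u ∈ D)

  range : {k : ℕ} → (Fin k → Fin n) → Pred (Fin n) 0ℓ
  range s u = ∃[ i ] s i ≡ u

  record IsTotalDominatingSequence {k : ℕ} (s : Fin k → Fin n) : Set where
    field
      legal      : IsLegal s
      dominating : IsTotalDominatingSet (range s)

  -- γgrᵗ≡ m says that m is the maximum length of a total dominating sequence.
  -- A graph with an isolated vertex has no such sequence, hence no such m.
  record γgrᵗ≡ (m : ℕ) : Set where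
    field
      attained : ∃ λ (s : Fin m → Fin n) → IsTotalDominatingSequence s
      maximal  : ∀ {k} (s : Fin k → Fin n) → IsTotalDominatingSequence s → k ≤ m

  γgrᵗ-unique : ∀ {m m′} → γgrᵗ≡ m → γgrᵗ≡ m′ → m ≡ m′
  γgrᵗ-unique p q with γgrᵗ≡.attained p | γgrᵗ≡.attained q
  ... | s , s-tds | t , t-tds =
    ≤-antisym (γgrᵗ≡.maximal q s s-tds) (γgrᵗ≡.maximal p t t-tds)

  -- A set of (unordered) edges is given by the symmetric relation "uv ∈ M".
  record IsPerfectMatching (M : Rel (Fin n) 0ℓ) : Set where
    field
      symmetric : Symmetric M
      edges     : M ⇒ Adj
      disjoint  : ∀ {u v w} → M u v → M u w → v ≡ w
      covering  : ∀ u → ∃[ v ] M u v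

  HasPerfectMatching : Set₁
  HasPerfectMatching = ∃ λ (M : Rel (Fin n) 0ℓ) → IsPerfectMatching M

{-# OPTIONS --safe #-}

-- Both directions rest on one fact: in a finite graph without cycles, every
-- infinite walk backtracks, i.e. goes u, v, u at some point.
--
-- (⇒) If all n vertices form a legal sequence, sending each vertex to its
-- footprint is a permutation π with v adjacent to π v.  The walk
-- v, π v, π (π v), … can only backtrack if π (π v) ≡ v, so π is a fixed-point
-- free involution along edges.
--
-- (⇐) Let μ be the involution of a perfect matching, and let every vertex v try
-- to footprint its partner μ v.  This is legal if v is placed before all the
-- other neighbours of μ v.  An infinite chain v₀, v₁, … of violated constraints
-- gives the walk v₀, μ v₁, v₁, μ v₂, v₂, …, which never backtracks, so the
-- constraints can be sorted topologically.
module Submission where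

open import Data.Fin.Base as Fin using (Fin; zero; suc; toℕ; punchIn; punchOut)
open import Data.Fin.Properties as Fin
  using (_≟_; any?; all?; punchIn-injective; punchInᵢ≢i; punchOut-injective;
         injective⇒≤; <⇒notInjective; ℕ→Fin-notInjective; toℕ-inject₁; toℕ-fromℕ; toℕ≤pred[n])
open import Data.Nat.Base using (ℕ; zero; suc; _+_; _≤_; _<_; z≤n; s≤s; z<s; s<s)
open import Data.Nat.GeneralisedArithmetic using (fold)
open import Data.Nat.Induction using (<-rec)
open import Data.Nat.Properties as ℕ using (+-identityʳ; +-suc; +-assoc)
open import Data.Product.Base using (∃-syntax; _×_; _,_; proj₁; proj₂)
open import Function.Base using (_∘_; _on_)
open import Function.Bundles using (_⇔_; mk⇔)
open import Function.Definitions using (Injective; StrictlySurjective)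
open import Level using (0ℓ)
open import Relation.Binary.Core using (Rel)
open import Relation.Binary.Definitions using (Decidable; Trichotomous; tri<; tri≈; tri>)
open import Relation.Binary.PropositionalEquality
  using (_≡_; _≢_; refl; sym; trans; cong; subst; subst₂; ≢-sym)
open import Relation.Nullary using (¬_; ¬?; yes; no; contradiction)
open import Relation.Nullary.Decidable using (_×-dec_; decidable-stable)
open import Defs

apart⇒injective : ∀ {I A : Set} {_≺_ : Rel I 0ℓ} → Trichotomous _≡_ _≺_ → {f : I → A} →
                  (∀ {i j} → i ≺ j → f i ≢ f j) → Injective _≡_ _≡_ f
apart⇒injective compare apart {i} {j} eq with compare i j
... | tri< i≺j _ _ = contradiction eq (apart i≺j)
... | tri≈ _ i≡j _ = i≡j
... | tri> _ _ j≺i = contradiction (sym eq) (apart j≺i)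

-- If `v` were missed, punching it out of the codomain would inject `Fin (suc n)` into `Fin n`.
injective⇒surjective : ∀ {n} {f : Fin n → Fin n} →
                       Injective _≡_ _≡_ f → StrictlySurjective _≡_ f
injective⇒surjective {suc n} {f} f-inj v with any? (λ i → f i ≟ v)
... | yes hit  = hit
... | no  miss = contradiction
  (λ {i} {j} → f-inj ∘ punchOut-injective (v≢f i) (v≢f j))
  (<⇒notInjective (ℕ.n<1+n n))
  where
  v≢f : ∀ i → v ≢ f i
  v≢f i v≡fi = miss (i , sym v≡fi)

-- Well-foundedness is phrased by explicit sequences, so that a descent can be turned directly into
-- a walk.
NoDescent : ∀ {A : Set} → Rel A 0ℓ → Set
NoDescent {A} R = (v : ℕ → A) → ¬ (∀ i → R (v (suc i)) (v i))

minimal : ∀ {n} {R : Rel (Fin (suc n)) 0ℓ} → Decidable R → NoDescent R →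
          ∃[ x ] (∀ y → ¬ R y x)
minimal {n} {R} R? noDescent with any? (λ x → all? (λ y → ¬? (R? y x)))
... | yes min = min
-- Iterating the choice of a predecessor, from the arbitrary start `zero`, descends forever.
... | no ¬min = contradiction (λ i → proj₂ (below (fold zero (proj₁ ∘ below) i)))
                              (noDescent (fold zero (proj₁ ∘ below)))
  where
  below : ∀ x → ∃[ y ] R y x
  below x with any? (λ y → R? y x)
  ... | yes y<x = y<x
  ... | no  ¬y  = contradiction (x , λ y yRx → ¬y (y , yRx)) ¬min

-- A minimal element goes first; the others, indexed through `punchIn x`, inherit the absence of
-- descents and are sorted recursively.
topologicalSort : ∀ {n} {R : Rel (Fin n) 0ℓ} → Decidable R → NoDescent R →
                  ∃[ σ ] (Injective _≡_ _≡_ σ × (∀ {i j : Fin n} → j Fin.< i → ¬ R (σ i) (σ j)))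
topologicalSort {zero} R? noDescent = (λ ()) , (λ { {()} }) , λ { {()} }
topologicalSort {suc n} {R} R? noDescent
  with x , x-min ← minimal R? noDescent
  with τ , τ-inj , τ-sorted ← topologicalSort {R = R on punchIn x}
         (λ i j → R? (punchIn x i) (punchIn x j)) (λ v → noDescent (punchIn x ∘ v))
  = σ , σ-inj , σ-sorted
  where
  σ : Fin (suc n) → Fin (suc n)
  σ zero    = x
  σ (suc i) = punchIn x (τ i)

  σ-inj : Injective _≡_ _≡_ σ
  σ-inj {zero}  {zero}  _  = refl
  σ-inj {zero}  {suc j} eq = contradiction (sym eq) (punchInᵢ≢i x (τ j))
  σ-inj {suc i} {zero}  eq = contradiction eq (punchInᵢ≢i x (τ i))
  σ-inj {suc i} {suc j} eq = cong suc (τ-inj (punchIn-injective x _ _ eq))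

  σ-sorted : ∀ {i j} → j Fin.< i → ¬ R (σ i) (σ j)
  σ-sorted {suc i} {zero}  _         = x-min (punchIn x (τ i))
  σ-sorted {suc i} {suc j} (s<s j<i) = τ-sorted j<i

module _ {n : ℕ} (G : Graph n) where
  open Graph G renaming (sym to adj-sym)

  NonBacktrackingWalk : (ℕ → Fin n) → Set
  NonBacktrackingWalk f = (∀ i → Adj (f i) (f (suc i))) × (∀ i → f i ≢ f (2 + i))

  module _ (acyclic : ¬ Cycle G) where

    -- A repetition of shortest gap would close up to a cycle.
    noRepetition : ∀ {f} → NonBacktrackingWalk f → ∀ d i → f i ≢ f (i + suc d)
    noRepetition {f} (walk , forward) = <-rec _ step
      where
      step : ∀ d → (∀ {e} → e < d → ∀ i → f i ≢ f (i + suc e)) →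
             ∀ i → f i ≢ f (i + suc d)
      -- The gap is `suc d`: gap 1 would be a loop and gap 2 a backtrack. From gap 3 on, the walk
      -- from `f i` to `f (i + d)` has at least three vertices, and its next step returns to `f i`.
      step 0 _ i eq = irrefl (trans eq (cong f (ℕ.+-comm i 1))) (walk i)
      step 1 _ i eq = forward i (trans eq (cong f (ℕ.+-comm i 2)))
      step d@(suc (suc _)) shorter i eq = acyclic record
        { 2≤m      = s≤s (s≤s z≤n)
        ; c        = c
        ; distinct = apart⇒injective Fin.<-cmp c-≢
        ; step     = λ a → subst₂ (λ k l → Adj (f (i + k)) (f l))
                             (sym (toℕ-inject₁ a)) (sym (+-suc i (toℕ a)))
                             (walk (i + toℕ a))
        ; close    = subst₂ Adj
                       (cong (λ k → f (i + k)) (sym (toℕ-fromℕ d)))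
                       (trans (cong f (sym (+-suc i d)))
                         (trans (sym eq) (cong f (sym (+-identityʳ i)))))
                       (walk (i + d))
        }
        where
        c : Fin (suc d) → Fin n
        c a = f (i + toℕ a)

        -- An equality would be a repetition of gap `suc e`, which is at most `toℕ b`, hence at most
        -- `d`.
        c-≢ : ∀ {a b} → a Fin.< b → c a ≢ c b
        c-≢ {a} {b} a<b eq′ with e , a+e≡b ← ℕ.m≤n⇒∃[o]m+o≡n a<b =
          shorter e<d (i + toℕ a) (trans eq′ (cong f i+b≡))
          where
          e<d : e < d
          e<d = ℕ.≤-trans (s≤s (ℕ.m≤n+m e (toℕ a)))
                  (ℕ.≤-trans (ℕ.≤-reflexive a+e≡b) (toℕ≤pred[n] b))
          i+b≡ : i + toℕ b ≡ i + toℕ a + suc e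
          i+b≡ = trans (cong (i +_) (trans (sym a+e≡b) (sym (+-suc (toℕ a) e))))
                       (sym (+-assoc i (toℕ a) (suc e)))

    noNonBacktrackingWalk : ∀ {f} → ¬ NonBacktrackingWalk f
    noNonBacktrackingWalk {f} walk = ℕ→Fin-notInjective f (apart⇒injective ℕ.<-cmp f-≢)
      where
      f-≢ : ∀ {i j} → i < j → f i ≢ f j
      f-≢ {i} i<j eq with d , i+d≡j ← ℕ.m≤n⇒∃[o]m+o≡n i<j =
        noRepetition walk d i (trans eq (cong f (trans (sym i+d≡j) (sym (+-suc i d)))))

    injectiveAlongEdges⇒involutive : ∀ {π : Fin n → Fin n} → Injective _≡_ _≡_ π →
                                     (∀ v → Adj v (π v)) → ∀ v → π (π v) ≡ v
    injectiveAlongEdges⇒involutive {π} π-inj adj-π v =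
      decidable-stable (π (π v) ≟ v) λ ππv≢v →
        noNonBacktrackingWalk {fold v π} (adj-π ∘ fold v π , forward ππv≢v)
      where
      forward : π (π v) ≢ v → ∀ i → fold v π i ≢ fold v π (2 + i)
      forward ππv≢v zero    = ≢-sym ππv≢v
      -- Cancelling one `π` moves a backtrack one step closer to the start.
      forward ππv≢v (suc i) = forward ππv≢v i ∘ π-inj

    spanningSequence⇒matching : {s : Fin n → Fin n} → IsTotalDominatingSequence G s →
                                HasPerfectMatching G
    spanningSequence⇒matching {s} tds = (λ u v → π u ≡ v) , record
      { symmetric = λ { refl → π-involutive _ }
      ; edges     = λ { refl → adj-π _ }
      ; disjoint  = λ { refl refl → refl }
      ; covering  = λ u → π u , refl
      }
      where
      open IsTotalDominatingSequence tds
      open IsLegal legal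

      -- Legality says nothing about the first vertex; domination supplies a neighbour of it, and no
      -- earlier vertex can interfere.
      footprint′ : ∀ i → ∃[ w ] (Adj (s i) w × (∀ j → j Fin.< i → ¬ Adj (s j) w))
      footprint′ zero    with u , u∈N , _ ← dominating (s zero) = u , u∈N , λ _ ()
      footprint′ (suc i) = footprint (suc i) z<s

      w : Fin n → Fin n
      w = proj₁ ∘ footprint′

      -- `w i` is already adjacent to `s i`, so a later vertex cannot footprint it.
      w-≢ : ∀ {i j} → i Fin.< j → w i ≢ w j
      w-≢ {i} {j} i<j eq =
        proj₂ (proj₂ (footprint′ j)) i i<j (subst (Adj (s i)) eq (proj₁ (proj₂ (footprint′ i))))

      w-inj : Injective _≡_ _≡_ w
      w-inj = apart⇒injective Fin.<-cmp w-≢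

      position : ∀ v → ∃[ i ] s i ≡ v
      position = injective⇒surjective distinct

      π : Fin n → Fin n
      π = w ∘ proj₁ ∘ position

      π-inj : Injective _≡_ _≡_ π
      π-inj {u} {v} eq =
        trans (sym (proj₂ (position u))) (trans (cong s (w-inj eq)) (proj₂ (position v)))

      adj-π : ∀ v → Adj v (π v)
      adj-π v with i , refl ← position v = proj₁ (proj₂ (footprint′ i))

      π-involutive : ∀ v → π (π v) ≡ v
      π-involutive = injectiveAlongEdges⇒involutive π-inj adj-π

    matching⇒spanningSequence : HasPerfectMatching G →
                                ∃[ s ] IsTotalDominatingSequence G {n} s
    matching⇒spanningSequence (M , perfect) = σ , record
      { legal = record
        { distinct  = σ-inj
        -- An earlier neighbour `σ j` of `μ (σ i)` would be one that `σ i` has to precede.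
        ; footprint = λ i _ → μ (σ i) , adj-μ (σ i) , λ j j<i adj →
            σ-sorted j<i (Fin.<⇒≢ j<i ∘ σ-inj , adj-sym adj)
        }
      ; dominating = λ v → μ v , adj-μ v , injective⇒surjective σ-inj (μ v)
      }
      where
      open IsPerfectMatching perfect

      μ : Fin n → Fin n
      μ = proj₁ ∘ covering

      adj-μ : ∀ v → Adj v (μ v)
      adj-μ = edges ∘ proj₂ ∘ covering

      μ-inj : Injective _≡_ _≡_ μ
      μ-inj {u} {v} eq = disjoint (symmetric (proj₂ (covering u)))
        (symmetric (subst (M v) (sym eq) (proj₂ (covering v))))

      -- Here `u` is a competing neighbour of the partner of `v`: placed first, it would spoil the
      -- footprint `μ v`.
      Precedes : Rel (Fin n) 0ℓ
      Precedes v u = u ≢ v × Adj (μ v) u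

      -- Recursion by two steps with a shift of `v` reduces every check on the walk to positions 0
      -- and 1 of a shifted sequence.
      zigzag : (ℕ → Fin n) → ℕ → Fin n
      zigzag v 0             = v 0
      zigzag v 1             = μ (v 1)
      zigzag v (suc (suc i)) = zigzag (v ∘ suc) i

      noDescent : NoDescent Precedes
      noDescent v desc = noNonBacktrackingWalk (walk v desc , forward v desc)
        where
        walk : ∀ v → (∀ i → Precedes (v (suc i)) (v i)) →
               ∀ i → Adj (zigzag v i) (zigzag v (suc i))
        walk v desc 0             = adj-sym (proj₂ (desc 0))
        walk v desc 1             = adj-sym (adj-μ (v 1))
        walk v desc (suc (suc i)) = walk (v ∘ suc) (desc ∘ suc) i

        forward : ∀ v → (∀ i → Precedes (v (suc i)) (v i)) →
                  ∀ i → zigzag v i ≢ zigzag v (2 + i)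
        forward v desc 0             = proj₁ (desc 0)
        forward v desc 1             = proj₁ (desc 1) ∘ μ-inj
        forward v desc (suc (suc i)) = forward (v ∘ suc) (desc ∘ suc) i

      sorted : ∃[ σ ] (Injective _≡_ _≡_ σ × (∀ {i j} → j Fin.< i → ¬ Precedes (σ i) (σ j)))
      sorted = topologicalSort (λ v u → ¬? (u ≟ v) ×-dec adj? (μ v) u) noDescent

      σ = proj₁ sorted
      σ-inj = proj₁ (proj₂ sorted)
      σ-sorted = proj₂ (proj₂ sorted)

mainTheorem8 : (n : ℕ) → 2 ≤ n → (T : Graph n) → IsTree T → γgrᵗ≡ T n ⇔ HasPerfectMatching T
mainTheorem8 n _ T tree = mk⇔
  (λ γ → spanningSequence⇒matching T acyclic (proj₂ (γgrᵗ≡.attained γ)))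
  (λ matching → record
    { attained = matching⇒spanningSequence T acyclic matching
    -- Distinct terms bound every length by `n`, so the value `n` only has to be attained.
    ; maximal  = λ _ tds → injective⇒≤ (IsLegal.distinct (IsTotalDominatingSequence.legal tds))
    })
  where open IsTree tree
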